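{- For every positive integer $k$, there exist graphs $G$ and $H$ such that $$\gamma_k^{\mathrm L}(G\square H)=\left\lceil\frac{n(G)\,n(H)}{k+1}\right\rceil;$$ that is, the lower bound $\gamma_k^{\mathrm L}(G\square H)\ge\left\lceil\frac{n(G)\,n(H)}{k+1}\right\rceil$, valid for all graphs $G$ and $H$, is attained.
   Context: All graphs are finite and simple; $n(G)=|V(G)|$, and $N_G(u)$ is the open neighborhood of $u$ in $G$. A set $D\subseteq V(G)$ is a dominating set if every vertex of $V(G)\setminus D$ has a neighbor in $D$. For an integer $k\ge 0$, a dominating set $D$ of $G$ is a $k$-limited dominating set if $|N_G(u)\setminus D|\le k$ for every $u\in D$. The $k$-limited domination number $\gamma_k^{\mathrm L}(G)$ is the minimum cardinality of a $k$-limited dominating set of $G$ (defined for all integers $k\ge 0$). The Cartesian product $G\square H$ has vertex set $V(G)\times V(H)$, with $(g,h)$ and $(g',h')$ adjacent if and only if either $g=g'$ and $hh'\in E(H)$, or $h=h'$ and $gg'\in E(G)$. -}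

module Defs where

open import Data.Fin using (Fin; remQuot)
open import Data.Fin.Properties using (all?; any?) renaming (_≟_ to _≟ᶠ_)
open import Data.Fin.Subset using (Subset; _∈_; _∉_; _─_; ∣_∣; ⊤)
open import Data.Fin.Subset.Properties using (_∈?_; ∈⊤; anySubset?; p─⊤≡⊥; ∣⊥∣≡0)
open import Data.Nat using (ℕ; _*_; _≤_; _<_; NonZero; z≤n)
open import Data.Nat.Induction using (<-wellFounded)
open import Data.Nat.Properties using (_≤?_; _<?_; ≮⇒≥; m*n≢0; ≤-reflexive; ≤-trans)
open import Data.Product using (_×_; _,_; proj₁; proj₂; ∃; ∃-syntax)
open import Data.Sum using (_⊎_; inj₁; inj₂)
open import Data.Vec using (tabulate)
open import Function using (_on_)
open import Induction.WellFounded using (Acc; acc)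
open import Level using (0ℓ)
open import Relation.Binary using (Rel; Symmetric; Irreflexive; Decidable)
open import Relation.Binary.PropositionalEquality using (_≡_; refl; sym; trans; cong)
open import Relation.Nullary using (Dec; yes; no; does; contradiction)
open import Relation.Nullary.Decidable using (_×-dec_; _⊎-dec_; _→-dec_; ¬?)
import Relation.Unary as U

-- Finite simple graphs on the vertex set Fin order. As usual, a graph has at
-- least one vertex; adjacency, being a finite relation, is decidable.
record Graph : Set₁ where
  field
    order       : ℕ
    {{nonEmpty}} : NonZero order
    _~_         : Rel (Fin order) 0ℓ
    ~-sym       : Symmetric _~_
    ~-irrefl    : Irreflexive _≡_ _~_
    _~?_        : Decidable _~_

  Vertex : Set
  Vertex = Fin order

  N : Vertex → Subset order
  N u = tabulate λ v → does (u ~? v)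

open Graph public using (order)

-- The vertex (g , h) of the product is encoded as combine g h, with inverse
-- remQuot, so that the vertex set is again of the form Fin n.
infixl 7 _□_
_□_ : Graph → Graph → Graph
G □ H = record
  { order    = order G * order H
  ; nonEmpty = m*n≢0 (order G) (order H)
  ; _~_      = Adj on decode
  ; ~-sym    = λ where
      (inj₁ (e , a)) → inj₁ (sym e , H.~-sym a)
      (inj₂ (e , a)) → inj₂ (sym e , G.~-sym a)
  ; ~-irrefl = λ where
      refl (inj₁ (_ , a)) → H.~-irrefl refl a
      refl (inj₂ (_ , a)) → G.~-irrefl refl a
  ; _~?_     = λ i j → Adj? (decode i) (decode j)
  }
  where
  module G = Graph G
  module H = Graph H

  decode : Fin (order G * order H) → G.Vertex × H.Vertex
  decode = remQuot {order G} (order H)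

  Adj : Rel (G.Vertex × H.Vertex) 0ℓ
  Adj (g , h) (g′ , h′) = (g ≡ g′ × h H.~ h′) ⊎ (h ≡ h′ × g G.~ g′)

  Adj? : Decidable Adj
  Adj? (g , h) (g′ , h′) =
    ((g ≟ᶠ g′) ×-dec (h H.~? h′)) ⊎-dec ((h ≟ᶠ h′) ×-dec (g G.~? g′))

module _ (G : Graph) where
  open Graph G using (Vertex; N; _~_; _~?_)

  Dominating : U.Pred (Subset (order G)) 0ℓ
  Dominating D = ∀ (v : Vertex) → v ∉ D → ∃[ u ] (u ∈ D × v ~ u)

  dominating? : U.Decidable Dominating
  dominating? D = all? λ v →
    ¬? (v ∈? D) →-dec any? λ u → (u ∈? D) ×-dec (v ~? u)

module _ (k : ℕ) (G : Graph) where
  open Graph G using (Vertex; N)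

  LimitedDominating : U.Pred (Subset (order G)) 0ℓ
  LimitedDominating D =
    Dominating G D × (∀ (u : Vertex) → u ∈ D → ∣ N u ─ D ∣ ≤ k)

  limitedDominating? : U.Decidable LimitedDominating
  limitedDominating? D =
    dominating? G D ×-dec all? λ u → (u ∈? D) →-dec (∣ N u ─ D ∣ ≤? k)

  ⊤-limitedDominating : LimitedDominating ⊤
  ⊤-limitedDominating =
      (λ _ v∉⊤ → contradiction ∈⊤ v∉⊤)
    , λ u _ → ≤-trans
        (≤-reflexive (trans (cong ∣_∣ (p─⊤≡⊥ (N u))) (∣⊥∣≡0 (order G)))) z≤n

  IsMinimum : U.Pred (Subset (order G)) 0ℓ
  IsMinimum D =
    LimitedDominating D × (∀ D′ → LimitedDominating D′ → ∣ D ∣ ≤ ∣ D′ ∣)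

  minimum : ∃ IsMinimum
  minimum = descend ⊤ ⊤-limitedDominating (<-wellFounded _)
    where
    descend : ∀ D → LimitedDominating D → Acc _<_ ∣ D ∣ → ∃ IsMinimum
    descend D D-ld (acc rec)
      with anySubset? (λ D′ → limitedDominating? D′ ×-dec (∣ D′ ∣ <? ∣ D ∣))
    ... | yes (D′ , D′-ld , D′<D) = descend D′ D′-ld (rec D′<D)
    ... | no  none = D , D-ld , λ D′ D′-ld → ≮⇒≥ λ D′<D → none (D′ , D′-ld , D′<D)

  -- The k-limited domination number of G; any IsMinimum set has this size.
  γᴸ : ℕ
  γᴸ = ∣ proj₁ minimum ∣

{-# OPTIONS --safe #-}
-- Every vertex outside a k-limited dominating set D lies in N(u) ∖ D for some
-- u in D, and each of these sets has at most k elements; so n(G) ≤ (k + 1) |D|.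
-- Equality holds for K_{k+1} □ H with H arbitrary: the fibre {v} × V(H) over any
-- vertex v of K_{k+1} dominates, and (v , h) has exactly the k neighbours
-- (w , h), w ≠ v, outside the fibre.
module Submission where

open import Defs
open import Data.Nat using (ℕ; suc; _*_; NonZero)
open import Data.Integer using (+_; _≤_)
open import Data.Rational.Unnormalised using (_/_; ceiling)
open import Data.Product using (_×_; ∃₂)
open import Relation.Binary.PropositionalEquality using (_≡_)

open import Data.Fin using (Fin; zero; suc; combine)
open import Data.Fin.Properties using (remQuot-combine; combine-surjective) renaming (_≟_ to _≟ᶠ_)
open import Data.Fin.Subset using (Subset; inside; outside; _∈_; _∉_; _⊆_; _∪_; _─_; ∣_∣; ⊤; ⊥; ⁅_⁆)
open import Data.Fin.Subset.Properties
import Data.Integer as ℤ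
import Data.Integer.DivMod as ℤ
import Data.Integer.Properties as ℤ
import Data.Nat as ℕ
import Data.Nat.Properties as ℕ
open import Data.Product using (_,_; proj₁; proj₂; ∃-syntax)
open import Data.Sum using (_⊎_; inj₁; inj₂)
open import Data.Vec using ([]; _∷_; here; there)
open import Data.Vec.Properties using ([]=⇒lookup; lookup⇒[]=; lookup∘tabulate)
open import Function using (_∘_)
open import Relation.Binary.PropositionalEquality using (_≢_; refl; sym; trans; cong; subst; subst₂)
open import Relation.Nullary using (yes; no; does; contradiction)
open import Relation.Nullary.Decidable using (¬?; dec-true)

private
  variable
    m n : ℕ

-- Sizes of unions and images of finite subsets.

x∈p─q⇒x∉q : ∀ (p q : Subset n) {x} → x ∈ p ─ q → x ∉ q
x∈p─q⇒x∉q (_ ∷ p) (outside ∷ q) (there x∈) (there x∈q) = x∈p─q⇒x∉q p q x∈ x∈q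
x∈p─q⇒x∉q (_ ∷ p) (inside  ∷ q) (there x∈) (there x∈q) = x∈p─q⇒x∉q p q x∈ x∈q

∣p∪q∣≤∣p∣+∣q∣ : (p q : Subset n) → ∣ p ∪ q ∣ ℕ.≤ ∣ p ∣ ℕ.+ ∣ q ∣
∣p∪q∣≤∣p∣+∣q∣ []            []            = ℕ.z≤n
∣p∪q∣≤∣p∣+∣q∣ (outside ∷ p) (outside ∷ q) = ∣p∪q∣≤∣p∣+∣q∣ p q
∣p∪q∣≤∣p∣+∣q∣ (outside ∷ p) (inside  ∷ q) =
  subst (suc ∣ p ∪ q ∣ ℕ.≤_) (sym (ℕ.+-suc ∣ p ∣ ∣ q ∣)) (ℕ.s≤s (∣p∪q∣≤∣p∣+∣q∣ p q))
∣p∪q∣≤∣p∣+∣q∣ (inside  ∷ p) (outside ∷ q) = ℕ.s≤s (∣p∪q∣≤∣p∣+∣q∣ p q)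
-- A common element counts once on the left but twice on the right, whence the slack `n≤1+n`.
∣p∪q∣≤∣p∣+∣q∣ (inside  ∷ p) (inside  ∷ q) =
  ℕ.s≤s (ℕ.≤-trans (∣p∪q∣≤∣p∣+∣q∣ p q) (ℕ.+-monoʳ-≤ ∣ p ∣ (ℕ.n≤1+n _)))

⋃ : Subset m → (Fin m → Subset n) → Subset n
⋃ []            f = ⊥
⋃ (outside ∷ p) f = ⋃ p (f ∘ suc)
⋃ (inside  ∷ p) f = f zero ∪ ⋃ p (f ∘ suc)

∈⋃⁺ : ∀ (p : Subset m) (f : Fin m → Subset n) {i x} → i ∈ p → x ∈ f i → x ∈ ⋃ p f
∈⋃⁺ (_       ∷ p) f here        x∈fi = x∈p∪q⁺ (inj₁ x∈fi)
∈⋃⁺ (outside ∷ p) f (there i∈p) x∈fi = ∈⋃⁺ p (f ∘ suc) i∈p x∈fi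
∈⋃⁺ (inside  ∷ p) f (there i∈p) x∈fi = x∈p∪q⁺ (inj₂ (∈⋃⁺ p (f ∘ suc) i∈p x∈fi))

∈⋃⁻ : ∀ (p : Subset m) (f : Fin m → Subset n) {x} → x ∈ ⋃ p f → ∃[ i ] (i ∈ p × x ∈ f i)
∈⋃⁻ []            f x∈ = contradiction x∈ ∉⊥
∈⋃⁻ (outside ∷ p) f x∈ with i , i∈p , x∈fi ← ∈⋃⁻ p (f ∘ suc) x∈ = suc i , there i∈p , x∈fi
∈⋃⁻ (inside  ∷ p) f x∈ with x∈p∪q⁻ (f zero) _ x∈
... | inj₁ x∈f0 = zero , here , x∈f0
... | inj₂ x∈⋃ with i , i∈p , x∈fi ← ∈⋃⁻ p (f ∘ suc) x∈⋃ = suc i , there i∈p , x∈fi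

-- Union bound: `⋃` recurses on `p` just as `∣ p ∣` counts, so each `inside` entry contributes one
-- summand of size at most `k`.
∣⋃∣≤ : ∀ (p : Subset m) (f : Fin m → Subset n) {k} →
       (∀ i → i ∈ p → ∣ f i ∣ ℕ.≤ k) → ∣ ⋃ p f ∣ ℕ.≤ ∣ p ∣ * k
∣⋃∣≤ {n = n} [] f f≤k = ℕ.≤-reflexive (∣⊥∣≡0 n)
∣⋃∣≤ (outside ∷ p) f f≤k = ∣⋃∣≤ p (f ∘ suc) λ i → f≤k (suc i) ∘ there
∣⋃∣≤ (inside  ∷ p) f f≤k = ℕ.≤-trans (∣p∪q∣≤∣p∣+∣q∣ (f zero) _)
  (ℕ.+-mono-≤ (f≤k zero here) (∣⋃∣≤ p (f ∘ suc) λ i → f≤k (suc i) ∘ there))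

-- Encoded as a union of singletons, so that the union bound with `k = 1` limits its size by `m`.
image : (Fin m → Fin n) → Subset n
image f = ⋃ ⊤ λ i → ⁅ f i ⁆

∈image⁺ : ∀ (f : Fin m → Fin n) i → f i ∈ image f
∈image⁺ f i = ∈⋃⁺ ⊤ (λ i → ⁅ f i ⁆) ∈⊤ (x∈⁅x⁆ (f i))

∈image⁻ : ∀ (f : Fin m → Fin n) {x} → x ∈ image f → ∃[ i ] x ≡ f i
∈image⁻ f x∈ with i , _ , x∈⁅fi⁆ ← ∈⋃⁻ ⊤ (λ i → ⁅ f i ⁆) x∈ = i , x∈⁅y⁆⇒x≡y (f i) x∈⁅fi⁆

∣image∣≤ : ∀ (f : Fin m → Fin n) → ∣ image f ∣ ℕ.≤ m
∣image∣≤ {m} f = subst (∣ image f ∣ ℕ.≤_) (trans (ℕ.*-identityʳ _) (∣⊤∣≡n m))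
  (∣⋃∣≤ ⊤ (λ i → ⁅ f i ⁆) λ i _ → ℕ.≤-reflexive (∣⁅x⁆∣≡1 (f i)))

-- Neighbourhoods and the counting bound.

module _ (G : Graph) where
  open Graph G using (Vertex; N; _~_; _~?_)

  ∈N⁺ : {u v : Vertex} → u ~ v → v ∈ N u
  ∈N⁺ {u} {v} u~v =
    lookup⇒[]= v _ (trans (lookup∘tabulate _ v) (dec-true (u ~? v) u~v))

  ∈N⁻ : {u v : Vertex} → v ∈ N u → u ~ v
  ∈N⁻ {u} {v} v∈Nu
    -- If `u ~? v` is `no`, the second equation reads `false ≡ true`, so that case does not occur.
    with u ~? v | trans (sym (lookup∘tabulate (λ w → does (u ~? w)) v)) ([]=⇒lookup v∈Nu)
  ... | yes u~v | _ = u~v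

  order≤∣D∣*suc : ∀ {k D} → LimitedDominating k G D → order G ℕ.≤ ∣ D ∣ * suc k
  order≤∣D∣*suc {k} {D} (dominating , limited) = begin
    order G                 ≡⟨ ∣⊤∣≡n (order G) ⟨
    ∣ ⊤ {order G} ∣         ≤⟨ p⊆q⇒∣p∣≤∣q∣ {p = ⊤} (λ {v} _ → covered v) ⟩
    ∣ D ∪ ⋃ D outer ∣       ≤⟨ ∣p∪q∣≤∣p∣+∣q∣ D _ ⟩
    ∣ D ∣ ℕ.+ ∣ ⋃ D outer ∣ ≤⟨ ℕ.+-monoʳ-≤ ∣ D ∣ (∣⋃∣≤ D outer limited) ⟩
    ∣ D ∣ ℕ.+ ∣ D ∣ * k     ≡⟨ ℕ.*-suc ∣ D ∣ k ⟨
    ∣ D ∣ * suc k           ∎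
    where
    open ℕ.≤-Reasoning

    outer : Vertex → Subset (order G)
    outer u = N u ─ D

    covered : ∀ v → v ∈ D ∪ ⋃ D outer
    covered v with v ∈? D
    ... | yes v∈D = x∈p∪q⁺ (inj₁ v∈D)
    -- `Dominating` yields the edge as `v ~ u`, whereas `v ∈ N u` asks for `u ~ v`; hence the
    -- symmetry.
    ... | no  v∉D with u , u∈D , v~u ← dominating v v∉D =
      x∈p∪q⁺ (inj₂ (∈⋃⁺ D outer u∈D (x∈p∧x∉q⇒x∈p─q (∈N⁺ (Graph.~-sym G v~u)) v∉D)))

order≤γᴸ*suc : ∀ k G → order G ℕ.≤ γᴸ k G * suc k
order≤γᴸ*suc k G = order≤∣D∣*suc G (proj₁ (proj₂ (minimum k G)))

γᴸ≤∣D∣ : ∀ k G {D} → LimitedDominating k G D → γᴸ k G ℕ.≤ ∣ D ∣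
γᴸ≤∣D∣ k G = proj₂ (proj₂ (minimum k G)) _

-- The product of a complete graph with an arbitrary graph.

complete : ∀ n → {{NonZero n}} → Graph
complete n = record
  { order    = n
  ; _~_      = _≢_
  ; ~-sym    = λ u≢v v≡u → u≢v (sym v≡u)
  ; ~-irrefl = λ u≡v u≢v → u≢v u≡v
  ; _~?_     = λ u v → ¬? (u ≟ᶠ v)
  }

module _ (k : ℕ) (H : Graph) where
  private
    G□H = complete (suc k) □ H
    open Graph G□H using (Vertex; N; _~_)
    open Graph H using () renaming (_~_ to _~ᴴ_)

  -- Adjacency in `_□_` is defined on the pairs that `remQuot` decodes. Stating it on pairs gives
  -- the predicate to transport along `remQuot-combine`.
  Adjacent : (Fin (suc k) × Fin (order H)) → (Fin (suc k) × Fin (order H)) → Set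
  Adjacent (g , h) (g′ , h′) = (g ≡ g′ × h ~ᴴ h′) ⊎ (h ≡ h′ × g ≢ g′)

  ⟨_,_⟩ : Fin (suc k) → Fin (order H) → Vertex
  ⟨_,_⟩ = combine

  ⟨,⟩-~⁻ : ∀ {g g′ h h′} → ⟨ g , h ⟩ ~ ⟨ g′ , h′ ⟩ → Adjacent (g , h) (g′ , h′)
  ⟨,⟩-~⁻ {g} {g′} {h} {h′} =
    subst₂ Adjacent (remQuot-combine g h) (remQuot-combine g′ h′)

  ⟨,⟩-~⁺ : ∀ {g g′ h h′} → Adjacent (g , h) (g′ , h′) → ⟨ g , h ⟩ ~ ⟨ g′ , h′ ⟩
  ⟨,⟩-~⁺ {g} {g′} {h} {h′} =
    subst₂ Adjacent (sym (remQuot-combine g h)) (sym (remQuot-combine g′ h′))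

  fibre : Subset (order G□H)
  fibre = image ⟨ zero ,_⟩

  fibre-limitedDominating : LimitedDominating k G□H fibre
  fibre-limitedDominating = dominating , limited
    where
    dominating : Dominating G□H fibre
    dominating v v∉ with combine-surjective {suc k} {order H} v
    ... | zero  , h , refl = contradiction (∈image⁺ ⟨ zero ,_⟩ h) v∉
    ... | suc g , h , refl =
      ⟨ zero , h ⟩ , ∈image⁺ ⟨ zero ,_⟩ h , ⟨,⟩-~⁺ {suc g} {zero} (inj₂ (refl , λ ()))

    -- A neighbour with first coordinate `zero` lies in the fibre, so only the coordinates `suc g`
    -- with `g : Fin k` remain; this index set is where the bound `k` comes from.
    outer⊆image : ∀ h → N ⟨ zero , h ⟩ ─ fibre ⊆ image λ g → ⟨ suc g , h ⟩
    outer⊆image h {v} v∈ with combine-surjective {suc k} {order H} v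
    ... | zero   , h′ , refl = contradiction (∈image⁺ ⟨ zero ,_⟩ h′)
      (x∈p─q⇒x∉q (N ⟨ zero , h ⟩) fibre v∈)
    ... | suc g′ , h′ , refl
      with ⟨,⟩-~⁻ {zero} {suc g′} {h} {h′}
        (∈N⁻ G□H {⟨ zero , h ⟩} {⟨ suc g′ , h′ ⟩} (p─q⊆p (N ⟨ zero , h ⟩) fibre v∈))
    -- The case `inj₁` would require `zero ≡ suc g′`; the other one forces `h ≡ h′`.
    ...   | inj₂ (refl , _) = ∈image⁺ (λ g → ⟨ suc g , h ⟩) g′

    limited : ∀ u → u ∈ fibre → ∣ N u ─ fibre ∣ ℕ.≤ k
    limited u u∈ = let h , u≡ = ∈image⁻ ⟨ zero ,_⟩ u∈ in
      subst (λ u → ∣ N u ─ fibre ∣ ℕ.≤ k) (sym u≡)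
        (ℕ.≤-trans (p⊆q⇒∣p∣≤∣q∣ (outer⊆image h)) (∣image∣≤ λ g → ⟨ suc g , h ⟩))

  γᴸ-complete-□ : γᴸ k G□H ≡ order H
  γᴸ-complete-□ = ℕ.≤-antisym
    (ℕ.≤-trans (γᴸ≤∣D∣ k G□H fibre-limitedDominating) (∣image∣≤ ⟨ zero ,_⟩))
    -- The product has `suc k * order H` vertices, so `suc k` cancels from the counting bound.
    (ℕ.*-cancelʳ-≤ (order H) (γᴸ k G□H) (suc k)
      (subst (ℕ._≤ γᴸ k G□H * suc k) (ℕ.*-comm (suc k) (order H)) (order≤γᴸ*suc k G□H)))

-- Bounds for ceilings of fractions.

ceiling-≤ : ∀ n k d → n ℕ.≤ d * suc k → ceiling (+ n / suc k) ≤ + d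
ceiling-≤ n k d n≤d*K = subst (_ ≤_) (ℤ.neg-involutive (+ d)) (ℤ.neg-mono-≤ -d≤q)
  where
  -- `ceiling` unfolds to `- q` with `q` the floor of `- n / (k + 1)`, so the claim becomes
  -- `- d ≤ q`.
  q = (ℤ.- + n) ℤ./ + suc k

  -d*K<[1+q]*K : (ℤ.- + d) ℤ.* + suc k ℤ.< ℤ.suc q ℤ.* + suc k
  -d*K<[1+q]*K = begin-strict
    (ℤ.- + d) ℤ.* + suc k  ≡⟨ ℤ.neg-distribˡ-* (+ d) (+ suc k) ⟨
    ℤ.- (+ d ℤ.* + suc k)  ≡⟨ cong ℤ.-_ (ℤ.pos-* d (suc k)) ⟨
    ℤ.- + (d * suc k)      ≤⟨ ℤ.neg-mono-≤ (ℤ.+≤+ n≤d*K) ⟩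
    ℤ.- + n                <⟨ ℤ.n<s[n/ℕd]*d (ℤ.- + n) (suc k) ⟩
    ℤ.suc ((ℤ.- + n) ℤ./ℕ suc k) ℤ.* + suc k
      ≡⟨ cong (λ i → ℤ.suc i ℤ.* + suc k) (ℤ.div-pos-is-/ℕ (ℤ.- + n) (suc k)) ⟨
    ℤ.suc q ℤ.* + suc k    ∎
    where open ℤ.≤-Reasoning

  -d≤q : ℤ.- + d ≤ q
  -- Since division rounds down, `- n` is strictly below `(q + 1) * (k + 1)`. Cancelling leaves
  -- `- d < q + 1`, which over the integers is `- d ≤ q`.
  -d≤q = subst (ℤ.- + d ≤_) (ℤ.pred-suc q)
    (ℤ.i<j⇒i≤pred[j] {j = ℤ.suc q} (ℤ.*-cancelʳ-<-nonNeg {j = ℤ.suc q} (+ suc k) -d*K<[1+q]*K))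

≤-ceiling : ∀ n k d → d * suc k ℕ.≤ n → + d ≤ ceiling (+ n / suc k)
≤-ceiling n k d d*K≤n = subst (_≤ _) (ℤ.neg-involutive (+ d)) (ℤ.neg-mono-≤ q≤-d)
  where
  q = (ℤ.- + n) ℤ./ + suc k

  -- In this direction rounding down gives `q * (k + 1) ≤ - n`, and the factor cancels with no shift
  -- by one.
  q≤-d : q ≤ ℤ.- + d
  q≤-d = ℤ.*-cancelʳ-≤-pos q (ℤ.- + d) (+ suc k) (begin
    q ℤ.* + suc k          ≤⟨ ℤ.[n/d]*d≤n (ℤ.- + n) (+ suc k) ⟩
    ℤ.- + n                ≤⟨ ℤ.neg-mono-≤ (ℤ.+≤+ d*K≤n) ⟩
    ℤ.- + (d * suc k)      ≡⟨ cong ℤ.-_ (ℤ.pos-* d (suc k)) ⟩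
    ℤ.- (+ d ℤ.* + suc k)  ≡⟨ ℤ.neg-distribˡ-* (+ d) (+ suc k) ⟩
    (ℤ.- + d) ℤ.* + suc k  ∎)
    where open ℤ.≤-Reasoning

ceiling≤γᴸ : ∀ k G → ceiling (+ order G / suc k) ≤ + γᴸ k G
ceiling≤γᴸ k G = ceiling-≤ (order G) k (γᴸ k G) (order≤γᴸ*suc k G)

-- The fraction is exactly `order H`, the known value of `γᴸ`; this gives one inequality, and the
-- general lower bound gives the other.
γᴸ-complete-□≡ceiling : ∀ k H →
  + γᴸ k (complete (suc k) □ H) ≡ ceiling (+ (suc k * order H) / suc k)
γᴸ-complete-□≡ceiling k H = ℤ.≤-antisym
  (≤-ceiling (suc k * order H) k _ (ℕ.≤-reflexive
    (trans (cong (_* suc k) (γᴸ-complete-□ k H)) (ℕ.*-comm (order H) (suc k)))))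
  (ceiling≤γᴸ k (complete (suc k) □ H))

corollary12 : ∀ (k : ℕ) → .{{NonZero k}} →
    (∀ (G H : Graph) →
    ceiling (+ (order G * order H) / suc k) ≤ + γᴸ k (G □ H))
    × (∃₂ λ (G H : Graph) →
    + γᴸ k (G □ H) ≡ ceiling (+ (order G * order H) / suc k))
corollary12 k =
    (λ G H → ceiling≤γᴸ k (G □ H))
  -- Any graph may be the second factor; another copy of the complete graph is taken.
  , complete (suc k) , complete (suc k) , γᴸ-complete-□≡ceiling k (complete (suc k))
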